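{- Let $\mathbf{Base}$ be a category, let $\mathbf{Var}$, $\mathbf{Ctxt}$, $\mathbf{Carr}$ be subcategories of $\mathbf{Base}$ such that $\mathbf{Var}$ is small and $\mathbf{Var}$ is a subcategory of $\mathbf{Ctxt}$, let $\Xi=(\Pi,\alpha)$ be a footprint over $\mathbf{Var}$, and let $\mathbf{Sem}(\Xi)$ be a subcategory of the category $\mathbf{Struct}(\Xi)$ of all $\Xi$-structures with carriers in $\mathbf{Carr}$. Then $\mathcal{IC}=(\mathbf{Ctxt},\mathrm{Cstr},\mathrm{Intr},\models)$ is an institution, called an institution of constraints. That is: $\mathrm{Cstr}:\mathbf{Ctxt}\to\mathbf{Set}$ is a functor, $\mathrm{Intr}:\mathbf{Ctxt}^{op}\to\mathbf{Cat}$ is a functor, and the family of satisfaction relations $\models_K$, for $K\in\mathbf{Ctxt}$, satisfies the satisfaction condition: for every morphism $\varphi:K\to G$ in $\mathbf{Ctxt}$, every $\Xi$-constraint $(X\triangleright Exp,\beta)$ on $K$, and every interpretation $(\varrho,\mathcal{U})$ of $G$, $$\mathrm{Intr}(\varphi)(\varrho,\mathcal{U})\models_K (X\triangleright Exp,\beta)\quad\text{iff}\quad (\varrho,\mathcal{U})\models_G \mathrm{Cstr}(\varphi)(X\triangleright Exp,\beta).$$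
   Context: Composition is written in diagrammatic order: $f;g$ means first $f$, then $g$. $\mathbf{Set}$ is the category of sets and $\mathbf{Cat}$ the category of categories and functors. An institution consists of a category of signatures, a sentence functor from signatures to $\mathbf{Set}$, a contravariant model functor from signatures to $\mathbf{Cat}$, and, for each signature, a satisfaction relation between models and sentences, such that the satisfaction condition (truth is invariant under change of signature, as displayed in the claim) holds. Footprint. A footprint $\Xi=(\Pi,\alpha)$ over $\mathbf{Var}$ is a set $\Pi$ of feature symbols together with a map $\alpha$ assigning to each $P\in\Pi$ an object $\alpha P$ of $\mathbf{Var}$, the arity of $P$. Structures. A $\Xi$-structure $\mathcal{U}=(U,\Pi^{\mathcal U})$ is given by an object $U$ of $\mathbf{Carr}$ (the carrier) and a family $\Pi^{\mathcal U}=\{[[P]]^{\mathcal U}\mid P\in\Pi\}$ of subsets $[[P]]^{\mathcal U}\subseteq\mathbf{Base}(\alpha P,U)$. A homomorphism $\varsigma:\mathcal{U}\to\mathcal{V}$ is a morphism $\varsigma:U\to V$ in $\mathbf{Carr}$ such that, for all $P\in\Pi$ and all $\iota:\alpha P\to U$ in $\mathbf{Base}$, $\iota\in[[P]]^{\mathcal U}$ implies $\iota;\varsigma\in[[P]]^{\mathcal V}$. These, with identities and composition inherited from $\mathbf{Carr}$, form the category $\mathbf{Struct}(\Xi)$. Feature expressions. The (first-order) feature $\Xi$-expressions $Exp$ with arity $X$, written $X\triangleright Exp$, are defined inductively, with $X$ ranging in parallel over all objects of $\mathbf{Var}$: (1) $X\triangleright P(\varphi)$ for $P\in\Pi$ and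 $\varphi:\alpha P\to X$ in $\mathbf{Var}$; (2) $X\triangleright\top$; (3) $X\triangleright\bot$; (4) $X\triangleright(Exp_1\wedge Exp_2)$ for $X\triangleright Exp_1$ and $X\triangleright Exp_2$; (5) $X\triangleright(Exp_1\vee Exp_2)$ for $X\triangleright Exp_1$ and $X\triangleright Exp_2$; (6) $X\triangleright\neg Exp$ for $X\triangleright Exp$; (7) $X\triangleright(Exp_1\rightarrow_\varphi\exists(Y:Exp_2))$ and (8) $X\triangleright(Exp_1\rightarrow_\varphi\forall(Y:Exp_2))$ for $X\triangleright Exp_1$, $Y\triangleright Exp_2$ and any morphism $\varphi:X\to Y$ in $\mathbf{Var}$. Semantics of expressions. For a $\Xi$-structure $\mathcal{U}=(U,\Pi^{\mathcal U})$ and an expression $X\triangleright Exp$, the set $[[Exp]]^{\mathcal U}_X\subseteq\mathbf{Base}(X,U)$ is defined inductively: (1) $\iota\in[[P(\varphi)]]^{\mathcal U}_X$ iff $\varphi;\iota\in[[P]]^{\mathcal U}$; (2) $[[\top]]^{\mathcal U}_X=\mathbf{Base}(X,U)$; (3) $[[\bot]]^{\mathcal U}_X=\emptyset$; (4) conjunction is intersection; (5) disjunction is union; (6) negation is complement in $\mathbf{Base}(X,U)$; (7) $\iota\in[[(Exp_1\rightarrow_\varphi\exists(Y:Exp_2))]]^{\mathcal U}_X$ iff $\iota\in[[Exp_1]]^{\mathcal U}_X$ implies that there exists $\varrho:Y\to U$ in $\mathbf{Base}$ with $\varphi;\varrho=\iota$ and $\varrho\in[[Exp_2]]^{\mathcal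 U}_Y$; (8) $\iota\in[[(Exp_1\rightarrow_\varphi\forall(Y:Exp_2))]]^{\mathcal U}_X$ iff $\iota\in[[Exp_1]]^{\mathcal U}_X$ implies that $\varrho\in[[Exp_2]]^{\mathcal U}_Y$ for all $\varrho:Y\to U$ in $\mathbf{Base}$ with $\varphi;\varrho=\iota$. Sentences. Objects of $\mathbf{Ctxt}$ are called contexts (these are the signatures of the institution). A $\Xi$-constraint $(X\triangleright Exp,\beta)$ on a context $K$ is given by a feature $\Xi$-expression $X\triangleright Exp$ and a morphism $\beta:X\to K$ in $\mathbf{Ctxt}$. $\mathrm{Cstr}(K)$ is the set of all $\Xi$-constraints on $K$. For $\varphi:K\to G$ in $\mathbf{Ctxt}$, $\mathrm{Cstr}(\varphi)(X\triangleright Exp,\beta):=(X\triangleright Exp,\beta;\varphi)$. Models. An interpretation $(\iota,\mathcal{U})$ of a context $K$ is given by a $\Xi$-structure $\mathcal{U}=(U,\Pi^{\mathcal U})$ in $\mathbf{Sem}(\Xi)$ and a morphism $\iota:K\to U$ in $\mathbf{Base}$. A morphism $\varsigma:(\iota,\mathcal{U})\to(\varrho,\mathcal{V})$ of interpretations of $K$ is a morphism $\varsigma:\mathcal{U}\to\mathcal{V}$ in $\mathbf{Sem}(\Xi)$ with $\iota;\varsigma=\varrho$. $\mathrm{Intr}(K)$ is the category of all interpretations of $K$ and morphisms between them. For $\varphi:K\to G$ in $\mathbf{Ctxt}$, $\mathrm{Intr}(\varphi):\mathrm{Intr}(G)\to\mathrm{Intr}(K)$ is given by $\mathrm{Intr}(\varphi)(\varrho,\mathcal{V}):=(\varphi;\varrho,\mathcal{V})$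 on objects and sends a morphism $\varsigma$ to the same underlying morphism $\varsigma$. Satisfaction. For a context $K$, a constraint $(X\triangleright Exp,\beta)$ on $K$ and an interpretation $(\iota,\mathcal{U})$ of $K$: $(\iota,\mathcal{U})\models_K(X\triangleright Exp,\beta)$ iff $\beta;\iota\in[[Exp]]^{\mathcal U}_X$. -}

module Defs where

open import Data.Irrelevant as Irrelevant using (Irrelevant; [_])
open import Data.Product.Base using (Σ; ∃; _×_; _,_; proj₁; proj₂)
open import Data.Refinement.Base using (Refinement-syntax; _,_; value; proof)
open import Data.Refinement.Properties using (value-injective)
open import Function.Base using (_∘_)
import Function.Base as Fun
open import Function.Bundles using (_⇔_)
open import Function.Definitions using (Injective)
open import Level using (Level; _⊔_; suc)
open import Relation.Binary.Core using (Rel; REL)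
open import Relation.Binary.HeterogeneousEquality as ≅ using (_≅_)
open import Relation.Binary.PropositionalEquality.Core
  using (_≡_; refl; sym; trans; cong; cong₂)
open import Relation.Binary.PropositionalEquality.Properties
  using (isEquivalence)
open import Relation.Binary.Structures using (IsEquivalence)
open import Relation.Unary using (Pred; _∈_; _∩_; _∪_; ∁)
open import Relation.Unary.Polymorphic using (U; ∅)

private
  variable
    o o′ ℓ ℓ′ e e′ m n r : Level

-- Composition _⨾_ is in diagrammatic order throughout.

record Category (o ℓ : Level) : Set (suc (o ⊔ ℓ)) where
  infix  4 _⇒_
  infixr 9 _⨾_
  field
    Obj   : Set o
    _⇒_   : Obj → Obj → Set ℓ
    id    : ∀ {x} → x ⇒ x
    _⨾_   : ∀ {x y z} → x ⇒ y → y ⇒ z → x ⇒ z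
    idˡ   : ∀ {x y} (f : x ⇒ y) → id ⨾ f ≡ f
    idʳ   : ∀ {x y} (f : x ⇒ y) → f ⨾ id ≡ f
    assoc : ∀ {w x y z} (f : w ⇒ x) (g : x ⇒ y) (h : y ⇒ z) →
            (f ⨾ g) ⨾ h ≡ f ⨾ (g ⨾ h)

-- Without function extensionality, `Sets` and `Cats` satisfy the category
-- laws only up to pointwise equality of functions and functors, so they
-- need a category notion with an explicit equality of morphisms.

record Category≈ (o ℓ e : Level) : Set (suc (o ⊔ ℓ ⊔ e)) where
  infix  4 _⇒_ _≈_
  infixr 9 _⨾_
  field
    Obj           : Set o
    _⇒_           : Obj → Obj → Set ℓ
    _≈_           : ∀ {x y} → Rel (x ⇒ y) e
    ≈-equivalence : ∀ {x y} → IsEquivalence (_≈_ {x} {y})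
    id            : ∀ {x} → x ⇒ x
    _⨾_           : ∀ {x y z} → x ⇒ y → y ⇒ z → x ⇒ z
    ⨾-cong        : ∀ {x y z} {f f′ : x ⇒ y} {g g′ : y ⇒ z} →
                    f ≈ f′ → g ≈ g′ → (f ⨾ g) ≈ (f′ ⨾ g′)
    idˡ           : ∀ {x y} (f : x ⇒ y) → (id ⨾ f) ≈ f
    idʳ           : ∀ {x y} (f : x ⇒ y) → (f ⨾ id) ≈ f
    assoc         : ∀ {w x y z} (f : w ⇒ x) (g : x ⇒ y) (h : y ⇒ z) →
                    ((f ⨾ g) ⨾ h) ≈ (f ⨾ (g ⨾ h))

toCategory≈ : Category o ℓ → Category≈ o ℓ ℓ
toCategory≈ C = record
  { Obj           = Obj
  ; _⇒_           = _⇒_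
  ; _≈_           = _≡_
  ; ≈-equivalence = isEquivalence
  ; id            = id
  ; _⨾_           = _⨾_
  ; ⨾-cong        = cong₂ _⨾_
  ; idˡ           = idˡ
  ; idʳ           = idʳ
  ; assoc         = assoc
  }
  where open Category C

infix 10 _ᵒᵖ

_ᵒᵖ : Category o ℓ → Category o ℓ
C ᵒᵖ = record
  { Obj   = Obj
  ; _⇒_   = λ x y → y ⇒ x
  ; id    = id
  ; _⨾_   = λ f g → g ⨾ f
  ; idˡ   = idʳ
  ; idʳ   = idˡ
  ; assoc = λ f g h → sym (assoc h g f)
  }
  where open Category C

record FunctorData (C : Category o ℓ) (D : Category≈ o′ ℓ′ e) :
                   Set (o ⊔ ℓ ⊔ o′ ⊔ ℓ′) where
  private
    module C = Category C
    module D = Category≈ D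
  field
    F₀ : C.Obj → D.Obj
    F₁ : ∀ {x y} → x C.⇒ y → F₀ x D.⇒ F₀ y

record IsFunctor {C : Category o ℓ} {D : Category≈ o′ ℓ′ e}
                 (F : FunctorData C D) : Set (o ⊔ ℓ ⊔ e) where
  private
    module C = Category C
    module D = Category≈ D
  open FunctorData F
  field
    F-id : ∀ {x} → F₁ (C.id {x}) D.≈ D.id
    F-⨾  : ∀ {x y z} (f : x C.⇒ y) (g : y C.⇒ z) →
           F₁ (f C.⨾ g) D.≈ (F₁ f D.⨾ F₁ g)

record Functor (C : Category o ℓ) (D : Category o′ ℓ′) :
               Set (o ⊔ ℓ ⊔ o′ ⊔ ℓ′) where
  field
    functorData : FunctorData C (toCategory≈ D)
    isFunctor   : IsFunctor functorData
  open FunctorData functorData public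
  open IsFunctor isFunctor public

-- Strict equality of functors. The two morphisms F₁ f and G₁ f have
-- propositionally equal, but not definitionally equal, endpoints.

infix 4 _≐_

record _≐_ {C : Category o ℓ} {D : Category o′ ℓ′} (F G : Functor C D) :
           Set (o ⊔ ℓ ⊔ o′ ⊔ ℓ′) where
  private
    module C = Category C
    module F = Functor F
    module G = Functor G
  field
    ≐₀ : ∀ x → F.F₀ x ≡ G.F₀ x
    ≐₁ : ∀ {x y} (f : x C.⇒ y) → F.F₁ f ≅ G.F₁ f

open _≐_

module _ {C : Category o ℓ} where

  idF : Functor C C
  idF = record
    { functorData = record { F₀ = Fun.id ; F₁ = Fun.id }
    ; isFunctor   = record { F-id = refl ; F-⨾ = λ _ _ → refl }
    }

module _ {C : Category o ℓ} {D : Category o′ ℓ′} where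

  F₁-cong : (F : Functor C D) → let open Category C in
            ∀ {x x′ y y′} {f : x ⇒ y} {g : x′ ⇒ y′} → x ≡ x′ → y ≡ y′ →
            f ≅ g → Functor.F₁ F f ≅ Functor.F₁ F g
  F₁-cong F refl refl ≅.refl = ≅.refl

module _ {C : Category o ℓ} {D : Category o′ ℓ′} where

  infixr 9 _⨾F_

  _⨾F_ : {E : Category m n} → Functor C D → Functor D E → Functor C E
  F ⨾F G = record
    { functorData = record { F₀ = G.F₀ ∘ F.F₀ ; F₁ = G.F₁ ∘ F.F₁ }
    ; isFunctor   = record
      { F-id = trans (cong G.F₁ F.F-id) G.F-id
      ; F-⨾  = λ f g → trans (cong G.F₁ (F.F-⨾ f g)) (G.F-⨾ (F.F₁ f) (F.F₁ g))
      }
    }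
    where
    module F = Functor F
    module G = Functor G

  ≐-isEquivalence : IsEquivalence (_≐_ {C = C} {D = D})
  ≐-isEquivalence = record
    { refl  = record { ≐₀ = λ _ → refl ; ≐₁ = λ _ → ≅.refl }
    ; sym   = λ p → record
      { ≐₀ = λ x → sym (≐₀ p x) ; ≐₁ = λ f → ≅.sym (≐₁ p f) }
    ; trans = λ p q → record
      { ≐₀ = λ x → trans (≐₀ p x) (≐₀ q x)
      ; ≐₁ = λ f → ≅.trans (≐₁ p f) (≐₁ q f)
      }
    }

  ⨾F-cong : {E : Category m n} {F F′ : Functor C D} {G G′ : Functor D E} →
            F ≐ F′ → G ≐ G′ → F ⨾F G ≐ F′ ⨾F G′
  ⨾F-cong {F′ = F′} {G = G} p q = record
    { ≐₀ = λ x → trans (cong (Functor.F₀ G) (≐₀ p x)) (≐₀ q _)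
    ; ≐₁ = λ f → ≅.trans (F₁-cong G (≐₀ p _) (≐₀ p _) (≐₁ p f)) (≐₁ q _)
    }

Sets : ∀ ℓ → Category≈ (suc ℓ) ℓ ℓ
Sets ℓ = record
  { Obj           = Set ℓ
  ; _⇒_           = λ A B → A → B
  ; _≈_           = λ f g → ∀ a → f a ≡ g a
  ; ≈-equivalence = record
    { refl  = λ _ → refl
    ; sym   = λ p a → sym (p a)
    ; trans = λ p q a → trans (p a) (q a)
    }
  ; id            = Fun.id
  ; _⨾_           = λ f g → g ∘ f
  ; ⨾-cong        = λ {_} {_} {_} {f} {f′} {g} p q a → trans (cong g (p a)) (q (f′ a))
  ; idˡ           = λ _ _ → refl
  ; idʳ           = λ _ _ → refl
  ; assoc         = λ _ _ _ _ → refl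
  }

Cats : ∀ o ℓ → Category≈ (suc (o ⊔ ℓ)) (o ⊔ ℓ) (o ⊔ ℓ)
Cats o ℓ = record
  { Obj           = Category o ℓ
  ; _⇒_           = Functor
  ; _≈_           = _≐_
  ; ≈-equivalence = ≐-isEquivalence
  ; id            = idF
  ; _⨾_           = _⨾F_
  ; ⨾-cong        = ⨾F-cong
  ; idˡ           = λ _ → record { ≐₀ = λ _ → refl ; ≐₁ = λ _ → ≅.refl }
  ; idʳ           = λ _ → record { ≐₀ = λ _ → refl ; ≐₁ = λ _ → ≅.refl }
  ; assoc         = λ _ _ _ → record { ≐₀ = λ _ → refl ; ≐₁ = λ _ → ≅.refl }
  }

record RawInstitution (o ℓ e m n r : Level) :
                      Set (suc (o ⊔ ℓ ⊔ e ⊔ m ⊔ n ⊔ r)) where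
  field
    Sign : Category o ℓ
  open Category Sign
  field
    Sen  : FunctorData Sign (Sets e)
    Mod₀ : Obj → Category m n
    Mod₁ : ∀ {K G} → K ⇒ G → FunctorData (Mod₀ G) (toCategory≈ (Mod₀ K))
    Sat  : ∀ K → REL (Category.Obj (Mod₀ K)) (FunctorData.F₀ Sen K) r

record IsInstitution (I : RawInstitution o ℓ e m n r) :
                     Set (o ⊔ ℓ ⊔ e ⊔ m ⊔ n ⊔ r) where
  open RawInstitution I
  open Category Sign
  open FunctorData Sen using () renaming (F₀ to Sen₀; F₁ to Sen₁)
  field
    Sen-isFunctor  : IsFunctor Sen
    Mod₁-isFunctor : ∀ {K G} (φ : K ⇒ G) → IsFunctor (Mod₁ φ)

  Mod : FunctorData (Sign ᵒᵖ) (Cats m n)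
  Mod = record
    { F₀ = Mod₀
    ; F₁ = λ φ → record
      { functorData = Mod₁ φ ; isFunctor = Mod₁-isFunctor φ }
    }

  field
    Mod-isFunctor : IsFunctor Mod
    satisfaction  : ∀ {K G} (φ : K ⇒ G)
                    (E : Sen₀ K) (M : Category.Obj (Mod₀ G)) →
                    Sat K (FunctorData.F₀ (Mod₁ φ) M) E ⇔ Sat G M (Sen₁ φ E)

-- A class of objects is given by an injection into the objects of C, so
-- that a subcategory can be small (o′ = ℓ) while C is large. A class of
-- morphisms is given by a predicate; being in it is proof-irrelevant, so
-- morphisms of the subcategory are equal as soon as they are equal in C.

record Subcategory (C : Category o ℓ) (o′ : Level) :
                   Set (o ⊔ suc (o′ ⊔ ℓ)) where
  private
    module C = Category C
  field
    Obj           : Set o′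
    ⌊_⌋           : Obj → C.Obj
    ⌊⌋-injective  : Injective _≡_ _≡_ ⌊_⌋
    IsMorphism    : ∀ {x y} → Pred (⌊ x ⌋ C.⇒ ⌊ y ⌋) ℓ
    id-closed     : ∀ {x} → C.id ∈ IsMorphism {x} {x}
    ⨾-closed      : ∀ {x y z} {f : ⌊ x ⌋ C.⇒ ⌊ y ⌋} {g : ⌊ y ⌋ C.⇒ ⌊ z ⌋} →
                    f ∈ IsMorphism → g ∈ IsMorphism →
                    f C.⨾ g ∈ IsMorphism {x} {z}

  category : Category o′ ℓ
  category = record
    { Obj   = Obj
    ; _⇒_   = λ x y → [ f ∈ ⌊ x ⌋ C.⇒ ⌊ y ⌋ ∣ IsMorphism f ]
    ; id    = C.id , [ id-closed ]
    ; _⨾_   = λ f g → value f C.⨾ value g ,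
                      Irrelevant.zipWith ⨾-closed (proof f) (proof g)
    ; idˡ   = λ f → value-injective (C.idˡ (value f))
    ; idʳ   = λ f → value-injective (C.idʳ (value f))
    ; assoc = λ f g h → value-injective (C.assoc (value f) (value g) (value h))
    }

record Footprint {v ℓ} (Var : Category v ℓ) : Set (v ⊔ suc ℓ) where
  field
    Π : Set ℓ
    α : Π → Category.Obj Var

-- Levels: a type in Set ℓ is a set, a type of objects at another level may
-- be a proper class. Thus Base is locally small, and Var and the set of
-- feature symbols are small, which is what puts the expressions and the
-- constraints in Set ℓ. Var is given as a subcategory of Ctxt, so its
-- objects and morphisms reach Base along two inclusions.

module _ {o ℓ c r : Level} (Base : Category o ℓ)
         (Ctxt : Subcategory Base c) (Carr : Subcategory Base r)
         (Var : Subcategory (Subcategory.category Ctxt) ℓ)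
         (Ξ : Footprint (Subcategory.category Var)) where

  private
    module B = Category Base
    module Ctxt where
      open Subcategory Ctxt public using (⌊_⌋)
      open Category (Subcategory.category Ctxt) public
    module Carr where
      open Subcategory Carr public using (⌊_⌋)
      open Category (Subcategory.category Carr) public
    module Var where
      open Category (Subcategory.category Var) public
      inCtxt : Obj → Ctxt.Obj
      inCtxt = Subcategory.⌊_⌋ Var
      inBase : Obj → B.Obj
      inBase X = Ctxt.⌊ inCtxt X ⌋
      inBase₁ : ∀ {X Y} → X ⇒ Y → inBase X B.⇒ inBase Y
      inBase₁ φ = value (value φ)
  open Footprint Ξ

  record Structure : Set (r ⊔ suc ℓ) where
    field
      carrier : Carr.Obj
    carrierᴮ : B.Obj
    carrierᴮ = Carr.⌊ carrier ⌋
    field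
      feature : (P : Π) → Pred (Var.inBase (α P) B.⇒ carrierᴮ) ℓ

  open Structure

  IsHomomorphism : (𝒰 𝒱 : Structure) → Pred (carrier 𝒰 Carr.⇒ carrier 𝒱) ℓ
  IsHomomorphism 𝒰 𝒱 ς =
    ∀ P (ι : Var.inBase (α P) B.⇒ carrierᴮ 𝒰) →
    ι ∈ feature 𝒰 P → ι B.⨾ value ς ∈ feature 𝒱 P

  private
    id-homo : ∀ {𝒰} → IsHomomorphism 𝒰 𝒰 Carr.id
    id-homo {𝒰} P ι ι∈ rewrite B.idʳ ι = ι∈

    ⨾-homo : ∀ {𝒰 𝒱 𝒲} {ς : carrier 𝒰 Carr.⇒ carrier 𝒱}
             {τ : carrier 𝒱 Carr.⇒ carrier 𝒲} →
             IsHomomorphism 𝒰 𝒱 ς → IsHomomorphism 𝒱 𝒲 τ →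
             IsHomomorphism 𝒰 𝒲 (ς Carr.⨾ τ)
    ⨾-homo {ς = ς} {τ} hς hτ P ι ι∈
      rewrite sym (B.assoc ι (value ς) (value τ)) = hτ P _ (hς P ι ι∈)

  Struct : Category (r ⊔ suc ℓ) ℓ
  Struct = record
    { Obj   = Structure
    ; _⇒_   = λ 𝒰 𝒱 → [ ς ∈ carrier 𝒰 Carr.⇒ carrier 𝒱 ∣ IsHomomorphism 𝒰 𝒱 ς ]
    ; id    = λ {𝒰} → Carr.id , [ id-homo {𝒰} ]
    ; _⨾_   = λ {𝒰} {𝒱} {𝒲} ς τ → value ς Carr.⨾ value τ ,
              Irrelevant.zipWith
                (⨾-homo {𝒰} {𝒱} {𝒲} {value ς} {value τ}) (proof ς) (proof τ)
    ; idˡ   = λ ς → value-injective (Carr.idˡ (value ς))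
    ; idʳ   = λ ς → value-injective (Carr.idʳ (value ς))
    ; assoc = λ ς τ υ → value-injective (Carr.assoc (value ς) (value τ) (value υ))
    }

  -- Exp X is the set of feature expressions with arity X.

  infixr 7 _∧_
  infixr 6 _∨_
  infix  8 ¬_
  infix  5 _→⟨_⟩∃_ _→⟨_⟩∀_

  data Exp (X : Var.Obj) : Set ℓ where
    _⟨_⟩    : (P : Π) → α P Var.⇒ X → Exp X
    ⊤ ⊥     : Exp X
    _∧_ _∨_ : Exp X → Exp X → Exp X
    ¬_      : Exp X → Exp X
    _→⟨_⟩∃_ : ∀ {Y} → Exp X → X Var.⇒ Y → Exp Y → Exp X
    _→⟨_⟩∀_ : ∀ {Y} → Exp X → X Var.⇒ Y → Exp Y → Exp X

  ⟦_⟧ : ∀ {X} → Exp X → (𝒰 : Structure) → Pred (Var.inBase X B.⇒ carrierᴮ 𝒰) ℓ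
  ⟦ P ⟨ φ ⟩ ⟧         𝒰   = λ ι → Var.inBase₁ φ B.⨾ ι ∈ feature 𝒰 P
  ⟦ ⊤ ⟧               𝒰   = U
  ⟦ ⊥ ⟧               𝒰   = ∅
  ⟦ E₁ ∧ E₂ ⟧         𝒰   = ⟦ E₁ ⟧ 𝒰 ∩ ⟦ E₂ ⟧ 𝒰
  ⟦ E₁ ∨ E₂ ⟧         𝒰   = ⟦ E₁ ⟧ 𝒰 ∪ ⟦ E₂ ⟧ 𝒰
  ⟦ ¬ E ⟧             𝒰   = ∁ (⟦ E ⟧ 𝒰)
  ⟦ E₁ →⟨ φ ⟩∃ E₂ ⟧   𝒰 ι = ι ∈ ⟦ E₁ ⟧ 𝒰 →
    ∃ λ ϱ → Var.inBase₁ φ B.⨾ ϱ ≡ ι × ϱ ∈ ⟦ E₂ ⟧ 𝒰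
  ⟦ E₁ →⟨ φ ⟩∀ E₂ ⟧   𝒰 ι = ι ∈ ⟦ E₁ ⟧ 𝒰 →
    ∀ ϱ → Var.inBase₁ φ B.⨾ ϱ ≡ ι → ϱ ∈ ⟦ E₂ ⟧ 𝒰

  record Constraint (K : Ctxt.Obj) : Set ℓ where
    constructor _▷_,_
    field
      X   : Var.Obj
      exp : Exp X
      β   : Var.inCtxt X Ctxt.⇒ K

  Cstr : FunctorData (Subcategory.category Ctxt) (Sets ℓ)
  Cstr = record
    { F₀ = Constraint
    ; F₁ = λ { φ (X ▷ E , β) → X ▷ E , (β Ctxt.⨾ φ) }
    }

  module _ {s : Level} (Sem : Subcategory Struct s) where

    private
      module Sem where
        open Subcategory Sem public using (⌊_⌋)
        open Category (Subcategory.category Sem) public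
        carrierOf : Obj → B.Obj
        carrierOf 𝒰 = carrierᴮ ⌊ 𝒰 ⌋
        inBase₁ : ∀ {𝒰 𝒱} → 𝒰 ⇒ 𝒱 → carrierOf 𝒰 B.⇒ carrierOf 𝒱
        inBase₁ ς = value (value (value ς))

    record Interpretation (K : Ctxt.Obj) : Set (s ⊔ ℓ) where
      field
        structure : Sem.Obj
        arrow     : Ctxt.⌊ K ⌋ B.⇒ Sem.carrierOf structure

    open Interpretation

    Intr₀ : Ctxt.Obj → Category (s ⊔ ℓ) ℓ
    Intr₀ K = record
      { Obj   = Interpretation K
      ; _⇒_   = λ I J → [ ς ∈ structure I Sem.⇒ structure J ∣
                          arrow I B.⨾ Sem.inBase₁ ς ≡ arrow J ]
      ; id    = λ {I} → Sem.id , [ B.idʳ (arrow I) ]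
      ; _⨾_   = λ {I} ς τ → value ς Sem.⨾ value τ ,
                Irrelevant.zipWith
                  (λ p q → trans (sym (B.assoc (arrow I) _ _))
                                 (trans (cong (B._⨾ _) p) q))
                  (proof ς) (proof τ)
      ; idˡ   = λ ς → value-injective (Sem.idˡ (value ς))
      ; idʳ   = λ ς → value-injective (Sem.idʳ (value ς))
      ; assoc = λ ς τ υ → value-injective (Sem.assoc (value ς) (value τ) (value υ))
      }

    Intr₁ : ∀ {K G} → K Ctxt.⇒ G →
            FunctorData (Intr₀ G) (toCategory≈ (Intr₀ K))
    Intr₁ φ = record
      { F₀ = λ I → record
        { structure = structure I
        ; arrow     = value φ B.⨾ arrow I
        }
      ; F₁ = λ {I} ς → value ς ,
             Irrelevant.map
               (λ p → trans (B.assoc (value φ) (arrow I) _) (cong (value φ B.⨾_) p))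
               (proof ς)
      }

    Satisfies : ∀ K → REL (Interpretation K) (Constraint K) ℓ
    Satisfies K I (X ▷ E , β) = value β B.⨾ arrow I ∈ ⟦ E ⟧ Sem.⌊ structure I ⌋

    IC : RawInstitution c ℓ ℓ (s ⊔ ℓ) ℓ ℓ
    IC = record
      { Sign = Subcategory.category Ctxt
      ; Sen  = Cstr
      ; Mod₀ = Intr₀
      ; Mod₁ = Intr₁
      ; Sat  = Satisfies
      }

{-# OPTIONS --safe #-}
module Submission where

open import Defs
open import Data.Refinement.Base using (value)
open import Data.Refinement.Properties using (value-injective)
open import Function.Bundles using (mk⇔)
open import Relation.Binary.HeterogeneousEquality as ≅ using (_≅_)
open import Relation.Binary.PropositionalEquality.Core
  using (_≡_; refl; sym; cong; subst)

-- Along φ, a constraint changes only by β ↦ β;φ and an interpretation only by ϱ ↦ φ;ϱ; the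
-- expression and the structure stay fixed. Functoriality therefore comes down to unit and
-- associativity laws, and both sides of the satisfaction condition test the same arrow β;φ;ϱ,
-- bracketed differently, for membership in one set. The delicate point is strict equality of
-- functors: reindexed interpretations agree only propositionally, so `intrMorphism-≅` compares
-- their morphisms heterogeneously.

module Auxiliary {o c r s ℓ} (Base : Category o ℓ)
         (Ctxt : Subcategory Base c) (Carr : Subcategory Base r)
         (Var : Subcategory (Subcategory.category Ctxt) ℓ)
         (Ξ : Footprint (Subcategory.category Var))
         (Sem : Subcategory (Struct Base Ctxt Carr Var Ξ) s) where

  private
    module Intr K = Category (Intr₀ Base Ctxt Carr Var Ξ Sem K)

  interpretation-≡ : ∀ {K} {𝒰} {ι ι′} → ι ≡ ι′ →
    _≡_ {A = Intr.Obj K} (record { structure = 𝒰 ; arrow = ι })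
                         (record { structure = 𝒰 ; arrow = ι′ })
  interpretation-≡ = cong (λ ι → record { structure = _ ; arrow = ι })

  -- Reindexing leaves the underlying morphism of structures unchanged, so
  -- this reduces the strict functor laws of Intr to their object parts.
  intrMorphism-≅ : ∀ {K} {I I′ J J′ : Intr.Obj K} → I ≡ I′ → J ≡ J′ →
    {ς : Intr._⇒_ K I J} {τ : Intr._⇒_ K I′ J′} →
    value ς ≅ value τ → ς ≅ τ
  intrMorphism-≅ refl refl p = ≅.≡-to-≅ (value-injective (≅.≅-to-≡ p))

theorem49 : ∀ {o c r s ℓ} (Base : Category o ℓ)
    (Ctxt : Subcategory Base c) (Carr : Subcategory Base r)
    (Var : Subcategory (Subcategory.category Ctxt) ℓ)
    (Ξ : Footprint (Subcategory.category Var))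
    (Sem : Subcategory (Struct Base Ctxt Carr Var Ξ) s) →
    IsInstitution (IC Base Ctxt Carr Var Ξ Sem)
theorem49 Base Ctxt Carr Var Ξ Sem = record
    { Sen-isFunctor  = record
      { F-id = λ { (X ▷ E , β) → cong (X ▷ E ,_) (Ctxt.idʳ β) }
      ; F-⨾  = λ { φ ψ (X ▷ E , β) → cong (X ▷ E ,_) (sym (Ctxt.assoc β φ ψ)) }
      }
    ; Mod₁-isFunctor = λ φ → record
      -- Both sides share the same `Sem` morphism; the compatibility proofs are irrelevant.
      { F-id = value-injective refl
      ; F-⨾  = λ _ _ → value-injective refl
      }
    ; Mod-isFunctor  = record
      { F-id = record
        { ≐₀ = λ I → interpretation-≡ (B.idˡ _)
        ; ≐₁ = λ ς → intrMorphism-≅ (interpretation-≡ (B.idˡ _))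
                                    (interpretation-≡ (B.idˡ _)) ≅.refl
        }
      ; F-⨾  = λ φ ψ → record
        -- In the opposite category φ followed by ψ is ψ;φ in `Ctxt`, so this is (ψ;φ);ι = ψ;(φ;ι).
        { ≐₀ = λ I → interpretation-≡ (B.assoc _ _ _)
        ; ≐₁ = λ ς → intrMorphism-≅ (interpretation-≡ (B.assoc _ _ _))
                                    (interpretation-≡ (B.assoc _ _ _)) ≅.refl
        }
      }
    ; satisfaction   = λ { φ (X ▷ E , β) I → mk⇔
        -- No induction on E: transport along β;(φ;ι) = (β;φ);ι suffices.
        (subst (⟦_⟧ Base Ctxt Carr Var Ξ E _) (sym (B.assoc _ _ _)))
        (subst (⟦_⟧ Base Ctxt Carr Var Ξ E _) (B.assoc _ _ _)) }
    }
  where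
  module B = Category Base
  module Ctxt = Category (Subcategory.category Ctxt)
  open Auxiliary Base Ctxt Carr Var Ξ Sem
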